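{- For all integers $n \geq 5$ and $k \geq 2$ with $n > 2k$, $\sigma(\mathrm{GP}(n,k)) \leq 4$.
   Context: Surrounding Cops and Robbers on a finite simple graph $G$ with $k \geq 1$ cops and one robber: the cops first choose starting vertices (several cops may share a vertex), then the robber chooses a starting vertex not occupied by a cop, and thereafter the cops and the robber alternate moves, the cops moving first. In a move, each player may move to an adjacent vertex or stay put; the robber may never move to, or remain on, a vertex occupied by a cop, so if a cop moves onto the robber's vertex the robber is compelled to move to a neighbouring vertex not occupied by a cop. The cops win if at any time every neighbour of the robber's vertex is occupied by a cop; the robber wins if he avoids this forever. Play is with perfect information. The surrounding cop number $\sigma(G)$ is the least number of cops for which the cops have a winning strategy. For positive integers $n,k$ with $n > 2k$, the generalised Petersen graph $\mathrm{GP}(n,k)$ has vertex set $\{a_0,\dots,a_{n-1}\} \cup \{b_0,\dots,b_{n-1}\}$ and edges $\{a_i,a_{i+1}\}$, $\{a_i,b_i\}$, $\{b_i,b_{i+k}\}$ for each $i \in \{0,\dots,n-1\}$, subscripts modulo $n$. -}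

module Defs where

open import Data.Nat using (ℕ; zero; suc; _+_; _≤_)
open import Data.Fin using (Fin; toℕ)
open import Data.Product using (Σ; ∃; _×_; _,_; proj₁; proj₂)
open import Data.Sum using (_⊎_)
open import Data.List using (List; []; _∷_)
open import Relation.Nullary using (¬_)
open import Relation.Binary.PropositionalEquality using (_≡_)

-- Generic graph notions (a graph is a vertex type V with an adjacency
-- relation Adj, assumed symmetric and irreflexive).

Cops : ℕ → Set → Set
Cops m V = Fin m → V

Occupied : {V : Set} {m : ℕ} → Cops m V → V → Set
Occupied {m = m} C v = Σ (Fin m) λ i → C i ≡ v

Surrounded : {V : Set} (Adj : V → V → Set) {m : ℕ} → Cops m V → V → Set
Surrounded {V} Adj C r = (v : V) → Adj r v → Occupied C v

CloseMove : {V : Set} (Adj : V → V → Set) → V → V → Set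
CloseMove Adj u v = u ≡ v ⊎ Adj u v

State : ℕ → Set → Set
State m V = Cops m V × V

-- A (history dependent) cop strategy.  Histories are lists of states,
-- most recent first.  Each cop must move legally.
record CopStrategy {V : Set} (Adj : V → V → Set) (m : ℕ) : Set where
  field
    start : Cops m V
    next  : List (State m V) → Cops m V
    legal : (C : Cops m V) (r : V) (h : List (State m V)) (i : Fin m) →
            CloseMove Adj (C i) (next ((C , r) ∷ h) i)

-- A (history dependent) robber "strategy".  Its legality is not imposed;
-- instead an illegal robber move ends the play with a cop win (the robber
-- always has a legal move unless already surrounded).
record RobberStrategy (V : Set) (m : ℕ) : Set where
  field
    start : Cops m V → V
    move  : List (State m V) → Cops m V → V

module Play {V : Set} {Adj : V → V → Set} {m : ℕ}
            (σ : CopStrategy Adj m) (ρ : RobberStrategy V m) where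
  open CopStrategy σ renaming (start to cstart)
  open RobberStrategy ρ renaming (start to rstart)

  mutual
    state : ℕ → State m V
    state zero    = cstart , rstart cstart
    state (suc t) = next (history t) , move (history t) (next (history t))

    history : ℕ → List (State m V)
    history zero    = state zero ∷ []
    history (suc t) = state (suc t) ∷ history t

  CopWinAt : ℕ → Set
  CopWinAt zero = Occupied cstart (rstart cstart) ⊎ Surrounded Adj cstart (rstart cstart)
  CopWinAt (suc t) =
    Surrounded Adj (proj₁ (state (suc t))) (proj₂ (state t))          -- after the cops' move
    ⊎ (¬ CloseMove Adj (proj₂ (state t)) (proj₂ (state (suc t)))
       ⊎ Occupied (proj₁ (state (suc t))) (proj₂ (state (suc t))))
    ⊎ Surrounded Adj (proj₁ (state (suc t))) (proj₂ (state (suc t)))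

CopsWin : {V : Set} (Adj : V → V → Set) (m : ℕ) → Set
CopsWin {V} Adj m =
  Σ (CopStrategy Adj m) λ σ → (ρ : RobberStrategy V m) → ∃ λ t → Play.CopWinAt σ ρ t

-- σ(G) ≤ c : the least number (≥ 1) of cops that win is at most c
SurroundingCopNumber≤ : {V : Set} (Adj : V → V → Set) (c : ℕ) → Set
SurroundingCopNumber≤ Adj c = ∃ λ m → 1 ≤ m × m ≤ c × CopsWin Adj m

data GPVertex (n : ℕ) : Set where
  a : Fin n → GPVertex n
  b : Fin n → GPVertex n

-- j = i + s (mod n), written out for 0 ≤ s ≤ n
CycStep : (n s : ℕ) → Fin n → Fin n → Set
CycStep n s i j = toℕ i + s ≡ toℕ j ⊎ toℕ i + s ≡ toℕ j + n

data GPEdge (n k : ℕ) : GPVertex n → GPVertex n → Set where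
  outer : (i j : Fin n) → CycStep n 1 i j → GPEdge n k (a i) (a j)
  spoke : (i : Fin n) → GPEdge n k (a i) (b i)
  inner : (i j : Fin n) → CycStep n k i j → GPEdge n k (b i) (b j)

GPAdj : (n k : ℕ) → GPVertex n → GPVertex n → Set
GPAdj n k u v = GPEdge n k u v ⊎ GPEdge n k v u

{-# OPTIONS --safe #-}

-- Lift indices from ℤ/n to ℤ and let the robber have index x.  Two cops shadow him: they stay
-- on his level (outer or inner) at indices x − (1 + d₁) and x + (1 + d₂), copying his moves
-- along spokes and inner edges.  When he moves along the outer cycle, the shadow he runs away
-- from copies him and the other one waits, so d₁ + d₂ drops; hence he uses only finitely many
-- outer edges.  Between two such moves he is confined to one inner cycle with its spokes, and
-- the other two cops walk onto that cycle and squeeze him from both sides, which ends in a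
-- surrounding or in a further drop of d₁ + d₂.
module Submission where

open import Defs
open import Data.Nat as ℕ using (ℕ; zero; suc; s≤s; z≤n)
import Data.Nat.Properties as ℕ
open import Data.Integer using (ℤ; +_; -[1+_]; +[1+_]; _+_; _-_; -_; ∣_∣; 0ℤ; 1ℤ; -1ℤ)
import Data.Integer.Properties as ℤ
open import Data.Integer.DivMod using (_%ℕ_; _/ℕ_; n%ℕd<d; a≡a%ℕn+[a/ℕn]*n)
open import Data.Integer.Tactic.RingSolver using (solve-∀)
open import Data.Fin using (Fin; zero; suc; toℕ; fromℕ<)
open import Data.Fin.Properties using (all?; any?; toℕ<n; toℕ-fromℕ<; toℕ-injective)
import Data.Fin.Properties as Fin
open import Data.List using (List; []; _∷_)
open import Data.Maybe using (Maybe; just; nothing)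
open import Data.Product using (Σ; ∃; ∃₂; _×_; _,_; proj₁; proj₂)
open import Data.Sum using (_⊎_; inj₁; inj₂)
open import Relation.Nullary using (¬_; Dec; yes; no; contradiction)
open import Relation.Nullary.Decidable using (_⊎-dec_; map′)
open import Relation.Binary.Definitions using (Decidable; DecidableEquality)
open import Relation.Binary.PropositionalEquality hiding ([_])

-- Winning game trees and the strategies extracted from them.

module GameTree {V : Set} (Adj : V → V → Set) (m : ℕ) where

  Legal : Cops m V → Cops m V → Set
  Legal C C′ = ∀ i → CloseMove Adj (C i) (C′ i)

  mutual
    -- Being inductive, a tree has no infinite branch, so an inhabitant is a cop strategy that wins
    -- every play from this position after finitely many moves.
    data RobberToMove (C : Cops m V) (r : V) : Set where
      surrounded : Surrounded Adj C r → RobberToMove C r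
      branch     : (∀ r′ → CloseMove Adj r r′ → ¬ Occupied C r′ → CopsToMove C r′) →
                   RobberToMove C r

    data CopsToMove (C : Cops m V) (r : V) : Set where
      respond : ∀ C′ → Legal C C′ → RobberToMove C′ r → CopsToMove C r

  module Extract (_≟_ : DecidableEquality V) (adj? : Decidable Adj) (C₀ : Cops m V)
                 (opening : ∀ r → ¬ Occupied C₀ r → CopsToMove C₀ r) where

    close? : Decidable (CloseMove Adj)
    close? u v = (u ≟ v) ⊎-dec adj? u v

    occupied? : (C : Cops m V) (v : V) → Dec (Occupied C v)
    occupied? C v = any? λ i → C i ≟ v

    Plan : V → Set
    Plan r = Σ (Cops m V) λ C → CopsToMove C r

    extend : ∀ {r} → Maybe (Plan r) → (r′ : V) → Maybe (Plan r′)
    extend nothing r′ = nothing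
    extend (just (_ , respond _ _ (surrounded _))) r′ = nothing
    extend {r} (just (_ , respond C _ (branch f))) r′ with close? r r′ | occupied? C r′
    ... | yes c | no ¬o = just (C , f r′ c ¬o)
    ... | yes _ | yes _ = nothing
    ... | no _  | _     = nothing

    -- The position in the game tree depends only on the robber's moves; the recorded
    -- cop positions are compared with it afterwards, in follow.
    plan : (r : V) → List (State m V) → Maybe (Plan r)
    plan r [] with occupied? C₀ r
    ... | yes _ = nothing
    ... | no ¬o = just (C₀ , opening r ¬o)
    plan r ((_ , r₁) ∷ h) = extend (plan r₁ h) r

    -- Staying put is the default when the play is over, the robber has moved illegally, or the
    -- recorded cops differ from the planned ones. This keeps the strategy legal on histories that
    -- it never produces itself.
    follow : ∀ {r} → Cops m V → Maybe (Plan r) → Cops m V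
    follow C nothing = C
    follow C (just (C₁ , respond C₂ _ _)) with all? (λ i → C₁ i ≟ C i)
    ... | yes _ = C₂
    ... | no _  = C

    follow-legal : ∀ {r} C (p : Maybe (Plan r)) → Legal C (follow C p)
    follow-legal C nothing i = inj₁ refl
    follow-legal C (just (C₁ , respond C₂ l _)) i with all? (λ i → C₁ i ≟ C i)
    ... | yes eq = subst (λ u → CloseMove Adj u (C₂ i)) (eq i) (l i)
    ... | no _   = inj₁ refl

    follow-just : ∀ {r} C₁ C₂ l w → follow {r} C₁ (just (C₁ , respond C₂ l w)) ≡ C₂
    follow-just C₁ C₂ l w with all? (λ i → C₁ i ≟ C₁ i)
    ... | yes _ = refl
    ... | no ¬p = contradiction (λ _ → refl) ¬p

    strategy : CopStrategy Adj m
    strategy = record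
      { start = C₀
      ; next  = λ { [] → C₀ ; ((C , r) ∷ h) → follow C (plan r h) }
      ; legal = λ C r h → follow-legal C (plan r h)
      }

    module _ (ρ : RobberStrategy V m) where
      open Play strategy ρ

      planAt : (t : ℕ) → Maybe (Plan (proj₂ (state t)))
      planAt zero    = plan (proj₂ (state zero)) []
      planAt (suc t) = extend (planAt t) (proj₂ (state (suc t)))

      next-follows : ∀ t → proj₁ (state (suc t)) ≡ follow (proj₁ (state t)) (planAt t)
      next-follows zero    = refl
      next-follows (suc t) = cong (follow (proj₁ (state (suc t)))) (plan≡ (suc t))
        where
        -- `tail t` is the history before time `t`, so that `history t` is `state t ∷ tail t`.
        tail : ℕ → List (State m V)
        tail zero    = []
        tail (suc t) = history t
        plan≡ : ∀ t → plan (proj₂ (state t)) (tail t) ≡ planAt t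
        plan≡ zero          = refl
        plan≡ (suc zero)    = refl
        plan≡ (suc (suc t)) = cong (λ p → extend p _) (plan≡ (suc t))

      mutual
        -- Structural recursion on the tree. The invariant is that the real cops stand where the
        -- tree says and that the plan at time `t` is this very tree.
        wins : ∀ t C₁ (w : CopsToMove C₁ (proj₂ (state t))) → proj₁ (state t) ≡ C₁ →
               planAt t ≡ just (C₁ , w) → ∃ CopWinAt
        wins t C₁ (respond C₂ l w) C≡ p≡ = wins′ t C₁ C₂ l w C₂≡ p≡
          where
          C₂≡ : proj₁ (state (suc t)) ≡ C₂
          C₂≡ = trans (next-follows t) (trans (cong₂ follow C≡ p≡) (follow-just C₁ C₂ l w))

        wins′ : ∀ t C₁ C₂ l (w : RobberToMove C₂ (proj₂ (state t))) →
                proj₁ (state (suc t)) ≡ C₂ →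
                planAt t ≡ just (C₁ , respond C₂ l w) → ∃ CopWinAt
        wins′ t C₁ C₂ l (surrounded s) C≡ p≡ =
          suc t , inj₁ (subst (λ C → Surrounded Adj C (proj₂ (state t))) (sym C≡) s)
        wins′ t C₁ C₂ l (branch f) C≡ p≡
          -- The equation for the plan is abstracted along with the two decisions on which `extend`
          -- branches, so that it reduces in each case.
          with close? (proj₂ (state t)) (proj₂ (state (suc t)))
             | occupied? C₂ (proj₂ (state (suc t)))
             | cong (λ p → extend p (proj₂ (state (suc t)))) p≡
        ... | no ¬c | _     | _  = suc t , inj₂ (inj₁ (inj₁ ¬c))
        ... | yes _ | yes o | _  =
          suc t , inj₂ (inj₁ (inj₂ (subst (λ C → Occupied C (proj₂ (state (suc t)))) (sym C≡) o)))
        ... | yes c | no ¬o | e  = wins (suc t) C₂ (f _ c ¬o) C≡ e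

      copsWinAt : ∃ CopWinAt
      copsWinAt with occupied? C₀ (proj₂ (state zero)) in eq
      ... | yes o = zero , inj₁ o
      ... | no ¬o = wins zero C₀ (opening _ ¬o) refl start≡
        where
        start≡ : planAt zero ≡ just (C₀ , opening _ ¬o)
        start≡ rewrite eq = refl

    copsWin : CopsWin Adj m
    copsWin = strategy , copsWinAt

-- Residues modulo n and their integer lifts.

module Residue (n : ℕ) {{_ : ℕ.NonZero n}} where
  open import Data.Integer using (_*_)

  +-swapʳ : ∀ u v w → u + v + w ≡ u + w + v
  +-swapʳ = solve-∀

  +-cancel-middle : ∀ u s v → u + s + v - s ≡ u + v
  +-cancel-middle = solve-∀

  -- Abstract, so that unification may solve [ x ] = [ y ] by x = y.
  abstract
    [_] : ℤ → Fin n
    [ z ] = fromℕ< (n%ℕd<d z n)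

    toℕ-[] : ∀ z → z ≡ + toℕ [ z ] + (z /ℕ n) * + n
    toℕ-[] z = subst (λ r → z ≡ + r + (z /ℕ n) * + n) (sym (toℕ-fromℕ< (n%ℕd<d z n)))
                 (a≡a%ℕn+[a/ℕn]*n z n)

  -- The difference of the two remainders is a multiple of n of absolute value below n, hence zero.
  remainder-unique : ∀ {r j} p q → r ℕ.< n → j ℕ.< n →
                     + r + p * + n ≡ + j + q * + n → r ≡ j
  remainder-unique {r} {j} p q r<n j<n eq = ℤ.+-injective (ℤ.i-j≡0⇒i≡j (+ r) (+ j) diff≡0)
    where
    move : ∀ u v p q N → u + p * N ≡ v + q * N → u - v ≡ (q - p) * N
    move u v p q N e = trans (lhs u v p N) (trans (cong (λ w → w - (v + p * N)) e) (rhs v p q N))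
      where
      lhs : ∀ u v p N → u - v ≡ u + p * N - (v + p * N)
      lhs = solve-∀
      rhs : ∀ v p q N → v + q * N - (v + p * N) ≡ (q - p) * N
      rhs = solve-∀
    diff : + r - + j ≡ (q - p) * + n
    diff = move (+ r) (+ j) p q (+ n) eq
    small : ∣ q - p ∣ ℕ.* n ℕ.< n
    small = subst (ℕ._< n) (trans (cong ∣_∣ (trans (sym (ℤ.m-n≡m⊖n r j)) diff)) (ℤ.abs-* (q - p) (+ n)))
              (ℕ.≤-<-trans (ℤ.∣m⊝n∣≤m⊔n r j) (ℕ.⊔-lub r<n j<n))
    factor≡0 : ∀ f → f ℕ.* n ℕ.< n → f ≡ 0
    factor≡0 zero    _ = refl
    factor≡0 (suc f) h = contradiction (ℕ.<-≤-trans h (ℕ.m≤m+n n (f ℕ.* n))) (ℕ.<-irrefl refl)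
    diff≡0 : + r - + j ≡ 0ℤ
    diff≡0 = trans diff (cong (λ f → f * + n) (ℤ.∣i∣≡0⇒i≡0 {q - p} (factor≡0 ∣ q - p ∣ small)))

  []-unique : ∀ {j z} q → z ≡ + toℕ j + q * + n → j ≡ [ z ]
  []-unique {j} {z} q eq = toℕ-injective
    (remainder-unique q (z /ℕ n) (toℕ<n j) (toℕ<n [ z ]) (trans (sym eq) (toℕ-[] z)))

  []-toℕ : ∀ i → i ≡ [ + toℕ i ]
  []-toℕ i = []-unique 0ℤ (sym (ℤ.+-identityʳ (+ toℕ i)))

  []-periodic : ∀ z q → [ z ] ≡ [ z + q * + n ]
  []-periodic z q = []-unique (z /ℕ n + q) (trans (cong (_+ q * + n) (toℕ-[] z))
    (regroup (+ toℕ [ z ]) (z /ℕ n) q (+ n)))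
    where
    regroup : ∀ r p q N → r + p * N + q * N ≡ r + (p + q) * N
    regroup = solve-∀

  -- Reducing z - 1 instead of z gives a representative from 1 to n. The zero class is thus a full
  -- turn away, never at distance zero.
  positive-residue : ∀ z → ∃₂ λ d q → z ≡ +[1+ d ] + q * + n
  positive-residue z = (z - 1ℤ) %ℕ n , (z - 1ℤ) /ℕ n ,
    trans (split z) (trans (cong (λ w → 1ℤ + w) (a≡a%ℕn+[a/ℕn]*n (z - 1ℤ) n))
      (sym (ℤ.+-assoc 1ℤ (+ ((z - 1ℤ) %ℕ n)) ((z - 1ℤ) /ℕ n * + n))))
    where
    split : ∀ z → z ≡ 1ℤ + (z - 1ℤ)
    split = solve-∀

  negative-residue : ∀ z → ∃₂ λ d q → z ≡ -[1+ d ] + q * + n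
  negative-residue z with positive-residue (- z)
  ... | d , q , eq = d , - q ,
    trans (sym (ℤ.neg-involutive z)) (trans (cong -_ eq) (negate +[1+ d ] q (+ n)))
    where
    negate : ∀ u q N → - (u + q * N) ≡ - u + (- q) * N
    negate = solve-∀

  offset : ∀ x i u q → + toℕ i - x ≡ u + q * + n → i ≡ [ x + u ]
  offset x i u q eq = []-unique (- q) (trans (regroup₁ x u q (+ n))
    (trans (cong (λ w → x + w + (- q) * + n) (sym eq)) (regroup₂ x (+ toℕ i) _)))
    where
    regroup₁ : ∀ x u q N → x + u ≡ x + (u + q * N) + (- q) * N
    regroup₁ = solve-∀
    regroup₂ : ∀ x j w → x + (j - x) + w ≡ j + w
    regroup₂ = solve-∀

  below : ∀ x i → ∃ λ d → i ≡ [ x + -[1+ d ] ]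
  below x i with negative-residue (+ toℕ i - x)
  ... | d , q , eq = d , offset x i -[1+ d ] q eq

  above : ∀ x i → ∃ λ d → i ≡ [ x + +[1+ d ] ]
  above x i with positive-residue (+ toℕ i - x)
  ... | d , q , eq = d , offset x i +[1+ d ] q eq

  step-target : ∀ {s j} z → CycStep n s [ z ] j → j ≡ [ z + + s ]
  step-target {s} {j} z (inj₁ eq) = []-unique (z /ℕ n) (trans (cong (_+ + s) (toℕ-[] z))
    (trans (+-swapʳ (+ toℕ [ z ]) (z /ℕ n * + n) (+ s)) (cong (λ w → + w + (z /ℕ n) * + n) eq)))
  step-target {s} {j} z (inj₂ eq) = []-unique (1ℤ + z /ℕ n) (trans (cong (_+ + s) (toℕ-[] z))
    (trans (+-swapʳ (+ toℕ [ z ]) (z /ℕ n * + n) (+ s)) (trans (cong (λ w → + w + (z /ℕ n) * + n) eq)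
      (carry (+ toℕ j) (z /ℕ n) (+ n)))))
    where
    carry : ∀ u p N → u + N + p * N ≡ u + (1ℤ + p) * N
    carry = solve-∀

  step-source : ∀ {s j} z → CycStep n s j [ z ] → j ≡ [ z - + s ]
  step-source {s} {j} z (inj₁ eq) = []-unique (z /ℕ n) (trans (cong (_- + s) (toℕ-[] z))
    (trans (cong (λ w → + w + (z /ℕ n) * + n - + s) (sym eq))
      (+-cancel-middle (+ toℕ j) (+ s) (z /ℕ n * + n))))
  step-source {s} {j} z (inj₂ eq) = []-unique (z /ℕ n - 1ℤ) (trans (cong (_- + s) (toℕ-[] z))
    (trans (borrow (+ toℕ [ z ]) (z /ℕ n) (+ n) (+ s))
      (trans (cong (λ w → + w + (z /ℕ n - 1ℤ) * + n - + s) (sym eq))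
        (+-cancel-middle (+ toℕ j) (+ s) ((z /ℕ n - 1ℤ) * + n)))))
    where
    borrow : ∀ r p N s → r + p * N - s ≡ r + N + (p - 1ℤ) * N - s
    borrow = solve-∀

  -- Since s ≤ n, subtracting n at most once brings the sum back into range; the vertex found is
  -- then identified by `step-target`.
  step-exists : ∀ {s} z → s ℕ.≤ n → CycStep n s [ z ] [ z + + s ]
  step-exists {s} z s≤n with toℕ [ z ] ℕ.+ s ℕ.<? n
  ... | yes r+s<n = subst (CycStep n s [ z ]) (step-target z c) c
    where
    c : CycStep n s [ z ] (fromℕ< r+s<n)
    c = inj₁ (sym (toℕ-fromℕ< r+s<n))
  ... | no r+s≮n = subst (CycStep n s [ z ]) (step-target z c) c
    where
    n≤r+s : n ℕ.≤ toℕ [ z ] ℕ.+ s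
    n≤r+s = ℕ.≮⇒≥ r+s≮n
    r+s∸n<n : toℕ [ z ] ℕ.+ s ℕ.∸ n ℕ.< n
    r+s∸n<n = ℕ.+-cancelʳ-< n _ _ (subst (ℕ._< n ℕ.+ n) (sym (ℕ.m∸n+n≡m n≤r+s))
                (ℕ.+-mono-<-≤ (toℕ<n [ z ]) s≤n))
    c : CycStep n s [ z ] (fromℕ< r+s∸n<n)
    c = inj₂ (trans (sym (ℕ.m∸n+n≡m n≤r+s)) (cong (ℕ._+ n) (sym (toℕ-fromℕ< r+s∸n<n))))

-- The graph in integer coordinates, and its legal moves.

module Petersen (n k : ℕ) {{_ : ℕ.NonZero n}} (k≤n : k ℕ.≤ n) where
  open import Data.Integer using (_*_)
  open Residue n

  V : Set
  V = GPVertex n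

  Adj : V → V → Set
  Adj = GPAdj n k

  K : ℤ
  K = + k

  _≟ⱽ_ : DecidableEquality V
  a i ≟ⱽ a j = map′ (cong a) (λ { refl → refl }) (i Fin.≟ j)
  a i ≟ⱽ b j = no λ ()
  b i ≟ⱽ a j = no λ ()
  b i ≟ⱽ b j = map′ (cong b) (λ { refl → refl }) (i Fin.≟ j)

  cycStep? : ∀ s → Decidable (CycStep n s)
  cycStep? s i j = (toℕ i ℕ.+ s ℕ.≟ toℕ j) ⊎-dec (toℕ i ℕ.+ s ℕ.≟ toℕ j ℕ.+ n)

  edge? : Decidable (GPEdge n k)
  edge? (a i) (a j) = map′ (outer i j) (λ { (outer _ _ c) → c }) (cycStep? 1 i j)
  edge? (a i) (b j) = map′ (λ { refl → spoke i }) (λ { (spoke _) → refl }) (i Fin.≟ j)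
  edge? (b i) (a j) = no λ ()
  edge? (b i) (b j) = map′ (inner i j) (λ { (inner _ _ c) → c }) (cycStep? k i j)

  adj? : Decidable Adj
  adj? u v = edge? u v ⊎-dec edge? v u

  open GameTree Adj 4

  data Level : Set where
    out inn : Level

  opp : Level → Level
  opp out = inn
  opp inn = out

  at : Level → ℤ → V
  at out z = a [ z ]
  at inn z = b [ z ]

  data Along : Level → ℤ → V → Set where
    right    : ∀ {x} → Along out x (at out (x + 1ℤ))
    left     : ∀ {x} → Along out x (at out (x + -1ℤ))
    forward  : ∀ {x} → Along inn x (at inn (x + K))
    backward : ∀ {x} → Along inn x (at inn (x + - K))

  neighbour : ∀ L {x v} → Adj (at L x) v → v ≡ at (opp L) x ⊎ Along L x v
  neighbour out {x} (inj₁ (outer _ j c)) with refl ← step-target {1} {j} x c = inj₂ right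
  neighbour out     (inj₁ (spoke _)) = inj₁ refl
  neighbour out {x} (inj₂ (outer i _ c)) with refl ← step-source {1} {i} x c = inj₂ left
  neighbour inn {x} (inj₁ (inner _ j c)) with refl ← step-target {k} {j} x c = inj₂ forward
  neighbour inn     (inj₂ (spoke _)) = inj₁ refl
  neighbour inn {x} (inj₂ (inner i _ c)) with refl ← step-source {k} {i} x c = inj₂ backward

  data Move (L : Level) (x : ℤ) : V → Set where
    same  : ∀ L′ → Move L x (at L′ x)
    along : ∀ {v} → Along L x v → Move L x v

  move : ∀ L {x v} → CloseMove Adj (at L x) v → Move L x v
  move L (inj₁ refl) = same L
  move L (inj₂ adj) with neighbour L adj
  ... | inj₁ refl = same (opp L)
  ... | inj₂ al   = along al

  Close : V → V → Set
  Close = CloseMove Adj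

  stay : ∀ L {z z′} → z ≡ z′ → Close (at L z) (at L z′)
  stay L eq = inj₁ (cong (at L) eq)

  change : ∀ L L′ {z} → Close (at L z) (at L′ z)
  change out out = inj₁ refl
  change out inn = inj₂ (inj₁ (spoke _))
  change inn out = inj₂ (inj₂ (spoke _))
  change inn inn = inj₁ refl

  step-right : ∀ {z z′} → z + 1ℤ ≡ z′ → Close (at out z) (at out z′)
  step-right refl = inj₂ (inj₁ (outer _ _ (step-exists _ (ℕ.>-nonZero⁻¹ n))))

  step-forward : ∀ {z z′} → z + K ≡ z′ → Close (at inn z) (at inn z′)
  step-forward refl = inj₂ (inj₁ (inner _ _ (step-exists _ k≤n)))

  flip-close : ∀ {u v} → Close u v → Close v u
  flip-close (inj₁ eq)       = inj₁ (sym eq)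
  flip-close (inj₂ (inj₁ e)) = inj₂ (inj₂ e)
  flip-close (inj₂ (inj₂ e)) = inj₂ (inj₁ e)

  cancel-shift : ∀ {z z′ s} → z + - s ≡ z′ → z′ + s ≡ z
  cancel-shift {z} {s = s} refl = cancel z s
    where
    cancel : ∀ z s → z + - s + s ≡ z
    cancel = solve-∀

  step-left : ∀ {z z′} → z + -1ℤ ≡ z′ → Close (at out z) (at out z′)
  step-left eq = flip-close (step-right (cancel-shift eq))

  step-backward : ∀ {z z′} → z + - K ≡ z′ → Close (at inn z) (at inn z′)
  step-backward eq = flip-close (step-forward (cancel-shift eq))

  -- Formations of the four cops.

  team : V → V → V → V → Cops 4 V
  team h₁ h₂ s₁ s₂ zero                   = h₁
  team h₁ h₂ s₁ s₂ (suc zero)             = h₂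
  team h₁ h₂ s₁ s₂ (suc (suc zero))       = s₁
  team h₁ h₂ s₁ s₂ (suc (suc (suc zero))) = s₂

  all-move : ∀ {h₁ h₂ s₁ s₂ h₁′ h₂′ s₁′ s₂′} → Close h₁ h₁′ → Close h₂ h₂′ →
             Close s₁ s₁′ → Close s₂ s₂′ → Legal (team h₁ h₂ s₁ s₂) (team h₁′ h₂′ s₁′ s₂′)
  all-move c₁ c₂ c₃ c₄ zero                   = c₁
  all-move c₁ c₂ c₃ c₄ (suc zero)             = c₂
  all-move c₁ c₂ c₃ c₄ (suc (suc zero))       = c₃
  all-move c₁ c₂ c₃ c₄ (suc (suc (suc zero))) = c₄

  -- `d₁` and `d₂` count the indices strictly between the robber and each shadow in the lift to ℤ;
  -- they are not reduced modulo n.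
  shadows : Level → ℤ → ℕ → ℕ → V → V → Cops 4 V
  shadows L x d₁ d₂ = team (at L (x + -[1+ d₁ ])) (at L (x + +[1+ d₂ ]))

  Shadowed : ℕ → ℕ → Set
  Shadowed d₁ d₂ = ∀ L x s₁ s₂ → RobberToMove (shadows L x d₁ d₂ s₁ s₂) (at L x)

  -- Bringing the other two cops onto the robber's inner cycle.

  x+K*0 : ∀ x K → x + K * 0ℤ ≡ x
  x+K*0 = solve-∀

  x+K*1 : ∀ x K → x + K * 1ℤ ≡ x + K
  x+K*1 = solve-∀

  x+K*-1 : ∀ x K → x + K * -1ℤ ≡ x + - K
  x+K*-1 = solve-∀

  neg-suc : ∀ z m → z + -[1+ m ] + 1ℤ ≡ z + - (+ m)
  neg-suc z zero    = ℤ.+-assoc z -1ℤ 1ℤ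
  neg-suc z (suc m) = ℤ.+-assoc z -[1+ suc m ] 1ℤ

  -- Prep M x s: a cop at s can be on the inner cycle of b_x within M moves; the term K * e
  -- absorbs the robber's moves along that cycle.
  data Prep : ℕ → ℤ → V → Set where
    ready : ∀ {M x} e → Prep M x (at inn (x + K * e))
    walk  : ∀ {M x} e m → m ℕ.≤ M → Prep (suc M) x (at out (x + K * e + - (+ m)))
    climb : ∀ {M x} e m → m ℕ.≤ M → Prep (suc (suc M)) x (at inn (x + K * e + - (+ m)))

  -- The spoke that the cop aims at stays fixed; only its coordinate relative to the robber changes,
  -- from `e` to `e - e′`.
  prep-shift : ∀ {M x x′ s} e′ → x + K * e′ ≡ x′ → Prep M x s → Prep M x′ s
  prep-shift {x = x} e′ refl (ready e) =
    subst (Prep _ _) (cong (at inn) (regroup x K e e′)) (ready (e - e′))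
    where
    regroup : ∀ x K e e′ → x + K * e′ + K * (e - e′) ≡ x + K * e
    regroup = solve-∀
  prep-shift {x = x} e′ refl (walk e m m≤M) =
    subst (Prep _ _) (cong (at out) (regroup x K e e′ (- (+ m)))) (walk (e - e′) m m≤M)
    where
    regroup : ∀ x K e e′ u → x + K * e′ + K * (e - e′) + u ≡ x + K * e + u
    regroup = solve-∀
  prep-shift {x = x} e′ refl (climb e m m≤M) =
    subst (Prep _ _) (cong (at inn) (regroup x K e e′ (- (+ m)))) (climb (e - e′) m m≤M)
    where
    regroup : ∀ x K e e′ u → x + K * e′ + K * (e - e′) + u ≡ x + K * e + u
    regroup = solve-∀

  prep-step : ∀ {M x s} → Prep (suc M) x s → ∃ λ s′ → Close s s′ × Prep M x s′
  prep-step (ready e) = _ , inj₁ refl , ready e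
  prep-step {x = x} (walk e zero _) = at inn (x + K * e) ,
    subst (λ z → Close (at out z) (at inn (x + K * e))) (sym (ℤ.+-identityʳ _)) (change out inn) , ready e
  prep-step {x = x} (walk e (suc m) (s≤s m≤M)) = _ , step-right (neg-suc (x + K * e) m) , walk e m m≤M
  prep-step (climb e m m≤M) = _ , change inn out , walk e m m≤M

  -- The cop aims at the robber's own spoke, approaching from the left. The slack `M′` allows two
  -- cops to share one bound.
  prepared : ∀ x s → ∃ λ M → ∀ M′ → Prep (M ℕ.+ M′) x s
  prepared x (a i) with below x i
  ... | d , refl = suc (suc d) , λ M′ → subst (Prep _ x)
          (cong (λ z → at out (z + -[1+ d ])) (x+K*0 x K)) (walk 0ℤ (suc d) (s≤s (ℕ.m≤m+n d M′)))
  prepared x (b i) with below x i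
  ... | d , refl = suc (suc (suc d)) , λ M′ → subst (Prep _ x)
          (cong (λ z → at inn (z + -[1+ d ])) (x+K*0 x K)) (climb 0ℤ (suc d) (s≤s (ℕ.m≤m+n d M′)))

  -- Outer moves and the trapped robber.

  Closer : ℕ → ℕ → Set
  Closer d₁ d₂ = ∀ {d₁′ d₂′} → d₁′ ℕ.+ d₂′ ℕ.< d₁ ℕ.+ d₂ → Shadowed d₁′ d₂′

  -- A zero gap ahead would make the robber's new vertex occupied. So the gap ahead is positive and
  -- shrinks by one while the gap behind is kept, and the induction hypothesis `Closer` applies.
  horizontal : ∀ d₁ d₂ → Closer d₁ d₂ → ∀ {x s₁ s₂ r} → Along out x r →
    ¬ Occupied (shadows out x d₁ d₂ s₁ s₂) r → CopsToMove (shadows out x d₁ d₂ s₁ s₂) r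
  horizontal d₁ zero ih right ¬o = contradiction (suc zero , refl) ¬o
  horizontal d₁ (suc d₂) ih {x} right _ = respond _
    (all-move (step-right (+-swapʳ x -[1+ d₁ ] 1ℤ)) (stay out (sym (ℤ.+-assoc x 1ℤ +[1+ d₂ ])))
      (inj₁ refl) (inj₁ refl))
    (ih (ℕ.+-monoʳ-< d₁ (ℕ.n<1+n d₂)) out (x + 1ℤ) _ _)
  horizontal zero d₂ ih left ¬o = contradiction (zero , refl) ¬o
  horizontal (suc d₁) d₂ ih {x} left _ = respond _
    (all-move (stay out (sym (ℤ.+-assoc x -1ℤ -[1+ d₁ ]))) (step-left (+-swapʳ x +[1+ d₂ ] -1ℤ))
      (inj₁ refl) (inj₁ refl))
    (ih (ℕ.n<1+n _) out (x + -1ℤ) _ _)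

  -- Leaving a_x along the outer cycle, or waiting there, brings a shadow closer.
  trapped-out : ∀ d₁ d₂ → Closer d₁ d₂ → ∀ x s₂ →
    RobberToMove (shadows out x d₁ d₂ (at inn x) s₂) (at out x)
  trapped-out zero zero ih x s₂ = surrounded λ v adj → blocked (neighbour out adj)
    where
    blocked : ∀ {v} → v ≡ at inn x ⊎ Along out x v →
              Occupied (shadows out x zero zero (at inn x) s₂) v
    blocked (inj₁ refl)  = suc (suc zero) , refl
    blocked (inj₂ right) = suc zero , refl
    blocked (inj₂ left)  = zero , refl
  trapped-out (suc d₁) d₂ ih x s₂ = branch λ r c → reply (move out c)
    where
    reply : ∀ {r} → Move out x r → ¬ Occupied (shadows out x (suc d₁) d₂ (at inn x) s₂) r →
            CopsToMove (shadows out x (suc d₁) d₂ (at inn x) s₂) r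
    reply (same out) _  = respond _
      (all-move (step-right (neg-suc x (suc d₁))) (inj₁ refl) (inj₁ refl) (inj₁ refl))
      (ih (ℕ.n<1+n _) out x _ _)
    reply (same inn) ¬o = contradiction (suc (suc zero) , refl) ¬o
    reply (along al) ¬o = horizontal (suc d₁) d₂ ih al ¬o
  trapped-out zero (suc d₂) ih x s₂ = branch λ r c → reply (move out c)
    where
    reply : ∀ {r} → Move out x r → ¬ Occupied (shadows out x zero (suc d₂) (at inn x) s₂) r →
            CopsToMove (shadows out x zero (suc d₂) (at inn x) s₂) r
    reply (same out) _  = respond _
      (all-move (inj₁ refl) (step-left (ℤ.+-assoc x +[1+ suc d₂ ] -1ℤ)) (inj₁ refl) (inj₁ refl))
      (ih (ℕ.n<1+n _) out x _ _)
    reply (same inn) ¬o = contradiction (suc (suc zero) , refl) ¬o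
    reply (along al) ¬o = horizontal zero (suc d₂) ih al ¬o

  -- The robber may only wait or climb to a_x while the left shadow walks along the outer
  -- cycle to a_x; if he climbs, the right shadow climbs too and b_x is occupied behind him.
  trapped-inn : ∀ d₁ d₂ → Closer d₁ d₂ → ∀ x →
    RobberToMove (team (at out (x + -[1+ d₁ ])) (at inn (x + +[1+ d₂ ]))
                       (at inn (x + - K)) (at inn (x + K))) (at inn x)
  trapped-inn d₁ d₂ ih x = branch λ r c → reply (move inn c)
    where
    cops : Cops 4 V
    cops = team (at out (x + -[1+ d₁ ])) (at inn (x + +[1+ d₂ ])) (at inn (x + - K)) (at inn (x + K))
    blocked : ∀ {v} → v ≡ at out x ⊎ Along inn x v →
              Occupied (team (at out x) (at inn (x + +[1+ d₂ ])) (at inn (x + - K)) (at inn (x + K))) v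
    blocked (inj₁ refl)     = zero , refl
    blocked (inj₂ forward)  = suc (suc (suc zero)) , refl
    blocked (inj₂ backward) = suc (suc zero) , refl
    wait : ∀ d → d ≡ d₁ → CopsToMove cops (at inn x)
    wait zero refl = respond _
      (all-move (step-right (trans (ℤ.+-assoc x -1ℤ 1ℤ) (ℤ.+-identityʳ x)))
        (inj₁ refl) (inj₁ refl) (inj₁ refl))
      (surrounded λ v adj → blocked (neighbour inn adj))
    wait (suc d) refl = respond _
      (all-move (step-right (neg-suc x (suc d))) (inj₁ refl) (inj₁ refl) (inj₁ refl))
      -- The left gap is now `d`, so the hypothesis is restricted to sums below `d + d₂`.
      (trapped-inn d d₂ (λ lt → ih (ℕ.m<n⇒m<1+n lt)) x)
    reply : ∀ {r} → Move inn x r → ¬ Occupied cops r → CopsToMove cops r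
    reply (same out) _ = respond _
      (all-move (inj₁ refl) (change inn out) (step-forward (cancel-shift {s = K} refl)) (inj₁ refl))
      (trapped-out d₁ d₂ ih x _)
    reply (same inn) _ = wait d₁ refl
    reply (along forward)  ¬o = contradiction (suc (suc (suc zero)) , refl) ¬o
    reply (along backward) ¬o = contradiction (suc (suc zero) , refl) ¬o

  -- Squeezing on the inner cycle, and the induction on the gaps.

  squeezed : Level → ℤ → ℕ → ℕ → ℕ → ℕ → Cops 4 V
  squeezed L x d₁ d₂ e₁ e₂ =
    shadows L x d₁ d₂ (at inn (x + K * -[1+ e₁ ])) (at inn (x + K * +[1+ e₂ ]))

  mutual
    -- Until an outer move or a trap, `e₁ + e₂` drops each round. If the robber keeps his index, one
    -- inner cop steps closer; if he moves along the inner cycle, the cop ahead waits and the other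
    -- three copy him.
    squeeze : ∀ d₁ d₂ → Closer d₁ d₂ → ∀ L x e₁ e₂ →
              RobberToMove (squeezed L x d₁ d₂ e₁ e₂) (at L x)
    squeeze d₁ d₂ ih L x e₁ e₂ = branch λ r c → squeeze-reply d₁ d₂ ih L x e₁ e₂ (move L c)

    squeeze-reply : ∀ d₁ d₂ → Closer d₁ d₂ → ∀ L x e₁ e₂ {r} → Move L x r →
      ¬ Occupied (squeezed L x d₁ d₂ e₁ e₂) r → CopsToMove (squeezed L x d₁ d₂ e₁ e₂) r
    squeeze-reply d₁ d₂ ih L x (suc e₁) e₂ (same L′) _ = respond _
      (all-move (change L L′) (change L L′) (step-forward (advance x K -[1+ e₁ ])) (inj₁ refl))
      (squeeze d₁ d₂ ih L′ x e₁ e₂)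
      where
      advance : ∀ x K u → x + K * (-1ℤ + u) + K ≡ x + K * u
      advance = solve-∀
    squeeze-reply d₁ d₂ ih L x zero (suc e₂) (same L′) _ = respond _
      (all-move (change L L′) (change L L′) (inj₁ refl) (step-backward (advance x K +[1+ e₂ ])))
      (squeeze d₁ d₂ ih L′ x zero e₂)
      where
      advance : ∀ x K u → x + K * (1ℤ + u) + - K ≡ x + K * u
      advance = solve-∀
    squeeze-reply d₁ d₂ ih L x zero zero (same out) _ = respond _
      (all-move (change L out) (change L out) (step-forward (advance x K)) (inj₁ refl))
      (trapped-out d₁ d₂ ih x _)
      where
      advance : ∀ x K → x + K * -1ℤ + K ≡ x
      advance = solve-∀
    -- With both inner neighbours occupied, the shadows part: the left one takes the outer level and
    -- the right one the inner level.
    squeeze-reply d₁ d₂ ih L x zero zero (same inn) _ = respond _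
      (all-move (change L out) (change L inn) (stay inn (x+K*-1 x K)) (stay inn (x+K*1 x K)))
      (trapped-inn d₁ d₂ ih x)
    squeeze-reply d₁ d₂ ih .out x e₁ e₂ (along al@right) ¬o = horizontal d₁ d₂ ih al ¬o
    squeeze-reply d₁ d₂ ih .out x e₁ e₂ (along al@left)  ¬o = horizontal d₁ d₂ ih al ¬o
    squeeze-reply d₁ d₂ ih .inn x e₁ zero (along forward) ¬o =
      contradiction (suc (suc (suc zero)) , cong (at inn) (x+K*1 x K)) ¬o
    squeeze-reply d₁ d₂ ih .inn x e₁ (suc e₂) (along forward) _ = respond _
      (all-move (step-forward (+-swapʳ x _ K)) (step-forward (+-swapʳ x _ K))
        (step-forward (+-swapʳ x _ K)) (stay inn (regroup x K +[1+ e₂ ])))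
      (squeeze d₁ d₂ ih inn (x + K) e₁ e₂)
      where
      regroup : ∀ x K u → x + K * (1ℤ + u) ≡ x + K + K * u
      regroup = solve-∀
    squeeze-reply d₁ d₂ ih .inn x zero e₂ (along backward) ¬o =
      contradiction (suc (suc zero) , cong (at inn) (x+K*-1 x K)) ¬o
    squeeze-reply d₁ d₂ ih .inn x (suc e₁) e₂ (along backward) _ = respond _
      (all-move (step-backward (+-swapʳ x _ (- K))) (step-backward (+-swapʳ x _ (- K)))
        (stay inn (regroup x K -[1+ e₁ ])) (step-backward (+-swapʳ x _ (- K))))
      (squeeze d₁ d₂ ih inn (x + - K) e₁ e₂)
      where
      regroup : ∀ x K u → x + K * (-1ℤ + u) ≡ x + - K + K * u
      regroup = solve-∀

  -- Steps of length k taken n times return to the start, so a cop's coordinate along the inner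
  -- cycle matters only modulo n.
  inner-cycle-wraps : ∀ x e e′ q → e ≡ e′ + q * + n → at inn (x + K * e′) ≡ at inn (x + K * e)
  inner-cycle-wraps x e e′ q refl = cong b (trans ([]-periodic (x + K * e′) (K * q))
                                             (cong [_] (regroup x K e′ q (+ n))))
    where
    regroup : ∀ x K e q N → x + K * e + K * q * N ≡ x + K * (e + q * N)
    regroup = solve-∀

  -- Recursion on the number of moves that the two cops may still need; any outer move of the robber
  -- ends it through `horizontal`.
  approach : ∀ d₁ d₂ → Closer d₁ d₂ → ∀ M L x {s₁ s₂} → Prep M x s₁ → Prep M x s₂ →
             RobberToMove (shadows L x d₁ d₂ s₁ s₂) (at L x)
  -- At zero both cops are on the inner cycle. A negative lift for one and a positive lift for the
  -- other put them on opposite sides of the robber.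
  approach d₁ d₂ ih zero L x (ready e) (ready e′) with negative-residue e | positive-residue e′
  ... | e₁ , q , eq | e₂ , q′ , eq′ =
    subst₂ (λ s₁ s₂ → RobberToMove (shadows L x d₁ d₂ s₁ s₂) (at L x))
      (inner-cycle-wraps x e _ q eq) (inner-cycle-wraps x e′ _ q′ eq′) (squeeze d₁ d₂ ih L x e₁ e₂)
  approach d₁ d₂ ih (suc M) L x {s₁} {s₂} p₁ p₂ = branch λ r c → reply (move L c)
    where
    catch-up : ∀ {L′ x′} e → x + K * e ≡ x′ →
               (∀ u → Close (at L (x + u)) (at L′ (x′ + u))) →
               CopsToMove (shadows L x d₁ d₂ s₁ s₂) (at L′ x′)
    catch-up {L′} {x′} e eq copy with prep-step (prep-shift e eq p₁) | prep-step (prep-shift e eq p₂)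
    ... | s₁′ , c₁ , p₁′ | s₂′ , c₂ , p₂′ =
      respond _ (all-move (copy _) (copy _) c₁ c₂) (approach d₁ d₂ ih M L′ x′ p₁′ p₂′)
    reply : ∀ {r} → Move L x r → ¬ Occupied (shadows L x d₁ d₂ s₁ s₂) r →
            CopsToMove (shadows L x d₁ d₂ s₁ s₂) r
    reply (same L′)           _  = catch-up 0ℤ (x+K*0 x K) λ u → change L L′
    reply (along al@right)    ¬o = horizontal d₁ d₂ ih al ¬o
    reply (along al@left)     ¬o = horizontal d₁ d₂ ih al ¬o
    reply (along forward)     _  = catch-up 1ℤ (x+K*1 x K) λ u → step-forward (+-swapʳ x u K)
    reply (along backward)    _  = catch-up -1ℤ (x+K*-1 x K) λ u → step-backward (+-swapʳ x u (- K))

  -- Recursion on a strict bound `D` for the sum of the gaps provides the hypothesis `Closer`.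
  shadowed : ∀ D d₁ d₂ → d₁ ℕ.+ d₂ ℕ.< D → Shadowed d₁ d₂
  shadowed (suc D) d₁ d₂ d<D L x s₁ s₂ with prepared x s₁ | prepared x s₂
  ... | M₁ , p₁ | M₂ , p₂ =
    approach d₁ d₂ (λ lt → shadowed D _ _ (ℕ.<-≤-trans lt (ℕ.s≤s⁻¹ d<D))) (M₁ ℕ.+ M₂) L x
      (p₁ M₂) (subst (λ M → Prep M x s₂) (ℕ.+-comm M₂ M₁) (p₂ M₁))

  -- The opening position and the conclusion.

  origin : V
  origin = at out 0ℤ

  -- All cops start on one outer vertex, and its spoke lets two of them reach the robber's level in
  -- one move. The same index is lifted once below x and once above it, so these two become the
  -- shadows.
  opening : ∀ r → CopsToMove (team origin origin origin origin) r
  opening r with lift r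
    where
    lift : ∀ r → ∃₂ λ L x → r ≡ at L x
    lift (a i) = out , + toℕ i , cong a ([]-toℕ i)
    lift (b i) = inn , + toℕ i , cong b ([]-toℕ i)
  ... | L , x , refl with below x [ 0ℤ ] | above x [ 0ℤ ]
  ...   | d₁ , eq₁ | d₂ , eq₂ = respond _
    (all-move (arrive L eq₁) (arrive L eq₂) (inj₁ refl) (inj₁ refl))
    (shadowed (suc (d₁ ℕ.+ d₂)) d₁ d₂ ℕ.≤-refl L x origin origin)
    where
    arrive : ∀ L {z} → [ 0ℤ ] ≡ [ z ] → Close origin (at L z)
    arrive out eq = inj₁ (cong a eq)
    arrive inn eq = subst (λ i → Close origin (b i)) eq (change out inn)

  four-cops-win : CopsWin Adj 4
  four-cops-win = Extract.copsWin _≟ⱽ_ adj? _ λ r _ → opening r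

open import Data.Nat using (_≤_; _<_; _*_)

theorem27 : (n k : ℕ) → 5 ≤ n → 2 ≤ k → 2 * k < n →
    SurroundingCopNumber≤ (GPAdj n k) 4
theorem27 n@(suc _) k _ _ 2k<n = 4 , s≤s z≤n , ℕ.≤-refl ,
  Petersen.four-cops-win n k (ℕ.≤-trans (ℕ.m≤n*m k 2) (ℕ.<⇒≤ 2k<n))
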